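{- Let $\lambda$ be a partition. Then the sequence $\{E_m(\lambda)\}_{m=0}^{\infty}$ uniquely determines $\lambda$; that is, if $\lambda,\lambda'$ are partitions with $E_m(\lambda)=E_m(\lambda')$ for all $m\ge0$, then $\lambda=\lambda'$.
   Context: Partitions are identified with Young diagrams; cell $(i,j)$ (row $i$, column $j$) lies in $\lambda$ iff $j\le\lambda_i$. $h_{i,j}$ denotes the hook length of cell $(i,j)$ in $\lambda$. For a partition $\mu$ with $\mu_i\le\lambda_i$ for all $i$, place a pebble in each cell of $\mu$ inside $\lambda$. A local excitation move moves a pebble from $(i,j)$ to $(i+1,j+1)$ provided the cells $(i,j+1)$, $(i+1,j)$, $(i+1,j+1)$ are all unoccupied and $(i+1,j+1)$ lies in $\lambda$. An excited diagram of $\mu$ in $\lambda$ is the set of cells occupied by pebbles after some finite sequence (possibly empty) of local excitation moves; $\mathcal{E}_\mu(\lambda)$ is the set of these. The excitation factor is $E_\mu(\lambda)=\sum_{\varepsilon\in\mathcal{E}_\mu(\lambda)}\prod_{(i,j)\in\varepsilon}h_{i,j}$, and $E_m(\lambda):=E_{[m]}(\lambda)$ for the one-row partition $[m]$; by convention $E_0(\lambda)=1$ and $E_m(\lambda)=0$ if $m>\lambda_1$. -}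

module Defs where

open import Data.Nat using (ℕ; zero; suc; _+_; _*_; _∸_; _≤_; _<_; _≥_; _≡ᵇ_; _≤ᵇ_)
open import Data.Bool using (Bool; true; false; _∧_; _∨_; not; if_then_else_)
open import Data.List using (List; []; _∷_; length; map; foldr; _++_; concatMap; filterᵇ; upTo)
open import Data.Nat.ListAction using (sum; product)
open import Data.Bool.ListAction using (all; any)
open import Data.List.Relation.Unary.All using (All)
open import Data.List.Relation.Unary.Linked using (Linked)
open import Data.Product using (_×_; _,_; proj₁; proj₂)

record Partition : Set where
  constructor mkPartition
  field
    parts      : List ℕ
    decreasing : Linked _≥_ parts
    positive   : All (0 <_) parts
open Partition public

-- λ_i, 1-indexed, with λ_i = 0 for i = 0 or i > ℓ(λ)
row : List ℕ → ℕ → ℕ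
row []       _             = 0
row (x ∷ xs) zero          = 0
row (x ∷ xs) (suc zero)    = x
row (x ∷ xs) (suc (suc i)) = row xs (suc i)

col : List ℕ → ℕ → ℕ
col []       j = 0
col (x ∷ xs) j = (if j ≤ᵇ x then 1 else 0) + col xs j

Cell : Set
Cell = ℕ × ℕ   -- (row i, column j), both 1-indexed

inDiagram : List ℕ → Cell → Bool
inDiagram l (i , j) = (1 ≤ᵇ i) ∧ (1 ≤ᵇ j) ∧ (j ≤ᵇ row l i)

hook : List ℕ → Cell → ℕ
hook l (i , j) = (row l i ∸ j) + (col l j ∸ i) + 1

-- Configurations of pebbles: duplicate-free lists of cells, read as sets.

Config : Set
Config = List Cell

cellEq : Cell → Cell → Bool
cellEq (a , b) (c , d) = (a ≡ᵇ c) ∧ (b ≡ᵇ d)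

occ : Config → Cell → Bool
occ c x = any (cellEq x) c

sameSet : Config → Config → Bool
sameSet c d = all (occ d) c ∧ all (occ c) d

dedup : List Config → List Config
dedup []       = []
dedup (c ∷ cs) = c ∷ filterᵇ (λ d → not (sameSet c d)) (dedup cs)

cellsOf : List ℕ → Config
cellsOf mu = go 1 mu
  where
  go : ℕ → List ℕ → Config
  go i []       = []
  go i (m ∷ ms) = map (λ j → (i , suc j)) (upTo m) ++ go (suc i) ms

canMove : List ℕ → Config → Cell → Bool
canMove l c (i , j) =
  not (occ c (i , suc j)) ∧ not (occ c (suc i , j)) ∧
  not (occ c (suc i , suc j)) ∧ inDiagram l (suc i , suc j)

movesFrom : List ℕ → Config → List Config
movesFrom l c = go [] c
  where
  go : Config → Config → List Config
  go before []       = []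
  go before (x ∷ after) =
    (if canMove l c x
       then ((before ++ ((suc (proj₁ x) , suc (proj₂ x)) ∷ after)) ∷ [])
       else [])
    ++ go (before ++ (x ∷ [])) after

reachWithin : List ℕ → ℕ → List Config → List Config
reachWithin l zero    cs = dedup cs
reachWithin l (suc k) cs = reachWithin l k (dedup (cs ++ concatMap (movesFrom l) cs))

-- Every move increases the row of one pebble by 1, and rows stay ≤ ℓ(λ),
-- so |μ| * ℓ(λ) moves suffice to reach every excited diagram.
excitedDiagrams : List ℕ → List ℕ → List Config
excitedDiagrams l mu =
  reachWithin l (sum mu * length l) (cellsOf mu ∷ [])

containedIn : List ℕ → List ℕ → Bool
containedIn []       l = true
containedIn (m ∷ ms) [] = (m ≡ᵇ 0) ∧ containedIn ms []
containedIn (m ∷ ms) (x ∷ xs) = (m ≤ᵇ x) ∧ containedIn ms xs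

excitationFactor : List ℕ → List ℕ → ℕ
excitationFactor mu l =
  sum (map (λ ε → product (map (hook l) ε)) (excitedDiagrams l mu))

E : ℕ → Partition → ℕ
E zero    p = 1
E (suc m) p =
  if containedIn (suc m ∷ []) (parts p)
    then excitationFactor (suc m ∷ []) (parts p)
    else 0

{-# OPTIONS --safe #-}
-- A placement of the m pebbles is a weakly increasing sequence a₁ ≤ … ≤ aₘ, pebble j standing in
-- the cell (1 + aⱼ, j + aⱼ) of λ. Either the first pebble rests, or all pebbles have moved and form
-- a placement in λ without its first row. With n ≥ λ₁, this recursion gives by induction
--   ∑ₘ Eₘ(λ) ∏ m ≤ p < n, (u - p)  =  ∏ 1 ≤ j ≤ n, (u + λ′ⱼ - j + 1)
-- for all integers u. The left side depends on the sequence E only, and the right side has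
-- the pairwise distinct roots j - 1 - λ′ⱼ, which determine the column lengths λ′ⱼ and hence λ.

module Submission where

open import Defs
open import Data.Bool using (true; false; not; if_then_else_; T)
open import Data.Bool.Properties using (T-∧; T?)
open import Data.Empty using (⊥)
open import Data.Nat as ℕ using (ℕ; zero; suc; _≤_; _<_; _≥_; z≤n; s≤s; _<ᵇ_; _≡ᵇ_; _∸_; _⊔_)
open import Data.Nat.Induction using (<-rec)
open import Data.Nat.Properties
open import Data.Bool.ListAction using (all)
open import Data.Nat.ListAction using (sum; product)
open import Data.Nat.ListAction.Properties using (sum-++; sum-↭)
open import Data.Integer using (ℤ; +_; 0ℤ; 1ℤ; _+_; _-_; _*_)
import Data.Integer.Properties as ℤₚ
open import Data.Integer.Tactic.RingSolver using (solve-∀)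
open import Data.List using (List; []; _∷_; _++_; length; map; replicate; applyUpTo; concatMap)
open import Data.List.Properties using
  (++-assoc; ++-identityʳ; map-++; map-∘; map-cong-local; map-injective; length-replicate; length-map; ∷-injective)
open import Data.List.Membership.Propositional using (_∈_; _∉_; lose; find)
open import Data.List.Membership.Propositional.Properties
open import Data.List.Membership.Propositional.Properties.WithK using (unique∧set⇒bag)
open import Data.List.Relation.Binary.BagAndSetEquality using (∼bag⇒↭)
open import Data.List.Relation.Binary.Permutation.Propositional.Properties using () renaming (map⁺ to ↭-map⁺)
open import Data.List.Relation.Unary.All as All using (All; []; _∷_)
import Data.List.Relation.Unary.All.Properties as All
import Data.List.Relation.Unary.Linked.Properties as Linked
open import Data.List.Relation.Unary.Any using (here; there)
import Data.List.Relation.Unary.Any as Any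
import Data.List.Relation.Unary.Any.Properties as Any
open import Data.List.Relation.Unary.AllPairs using ([]; _∷_)
open import Data.List.Relation.Unary.Linked as Linked using (Linked; []; [-]; _∷_)
open import Data.List.Relation.Unary.Unique.Propositional using (Unique)
import Data.List.Relation.Unary.Unique.Propositional.Properties as Unique
open import Data.Product using (_×_; _,_; ∃-syntax; proj₁; proj₂)
open import Data.Product.Properties using (,-injectiveˡ; ,-injectiveʳ)
open import Data.Sum using (_⊎_; inj₁; inj₂)
open import Function using (_∘_; mk⇔; Equivalence)
open import Relation.Nullary using (¬_; yes; no; contradiction)
open import Relation.Binary.PropositionalEquality

-- The generating polynomial

row-suc-≤ : ∀ {l} → Linked _≥_ l → ∀ i → row l (suc (suc i)) ≤ row l (suc i)
row-suc-≤ []          _       = z≤n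
row-suc-≤ [-]         _       = z≤n
row-suc-≤ (x≥y ∷ _)   zero    = x≥y
row-suc-≤ (_   ∷ ys↘) (suc i) = row-suc-≤ ys↘ i

row-≤-head : ∀ {l} → Linked _≥_ l → ∀ i → row l (suc i) ≤ row l 1
row-≤-head l↘ zero    = ≤-refl
row-≤-head l↘ (suc i) = ≤-trans (row-suc-≤ l↘ i) (row-≤-head l↘ i)

-- The summand of `col` in column `suc k`: there the test `suc k ≤ᵇ x` computes to `k <ᵇ x`.
𝟙[_<_] : ℕ → ℕ → ℕ
𝟙[ k < x ] = if k <ᵇ x then 1 else 0

<⇒𝟙≡1 : ∀ {k x} → k < x → 𝟙[ k < x ] ≡ 1
<⇒𝟙≡1 {k} {x} k<x with true ← k <ᵇ x | _ ← <⇒<ᵇ k<x = refl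

≤⇒<ᵇ≡false : ∀ {k x} → x ≤ k → (k <ᵇ x) ≡ false
≤⇒<ᵇ≡false {k} {x} x≤k with k <ᵇ x in eq
... | false = refl
... | true  = contradiction (<ᵇ⇒< k x (subst T (sym eq) _)) (≤⇒≯ x≤k)

≤⇒𝟙≡0 : ∀ {k x} → x ≤ k → 𝟙[ k < x ] ≡ 0
≤⇒𝟙≡0 x≤k rewrite ≤⇒<ᵇ≡false x≤k = refl

𝟙-antitone : ∀ {i j} x → i ≤ j → 𝟙[ j < x ] ≤ 𝟙[ i < x ]
𝟙-antitone {i} {j} x i≤j with <-≤-connex j x
... | inj₁ j<x rewrite <⇒𝟙≡1 j<x | <⇒𝟙≡1 (≤-<-trans i≤j j<x) = ≤-refl
... | inj₂ x≤j rewrite ≤⇒𝟙≡0 x≤j = z≤n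

col-antitone : ∀ l {i j} → i ≤ j → col l (suc j) ≤ col l (suc i)
col-antitone []      i≤j = z≤n
col-antitone (x ∷ l) i≤j = +-mono-≤ (𝟙-antitone x i≤j) (col-antitone l i≤j)

col-beyond : ∀ {l} → Linked _≥_ l → ∀ {k} → row l 1 ≤ k → col l (suc k) ≡ 0
col-beyond {[]}    _  _ = refl
col-beyond {x ∷ l} l↘ x≤k =
  cong₂ ℕ._+_ (≤⇒𝟙≡0 x≤k) (col-beyond (Linked.tail l↘) (≤-trans (row-suc-≤ l↘ 0) x≤k))

-- pebbleSum l k r is the sum of the hook products over all positions of r pebbles
-- that started in the cells (1, k + 1), …, (1, k + r). The first of them either rests,
-- or all of them have moved and live in the diagram without its first row.
pebbleSum : List ℕ → ℕ → ℕ → ℕ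
pebbleSum l       k zero    = 1
pebbleSum []      k (suc r) = 0
pebbleSum (x ∷ l) k (suc r) =
  (if k <ᵇ x then hook (x ∷ l) (1 , suc k) ℕ.* pebbleSum (x ∷ l) (suc k) r else 0)
  ℕ.+ pebbleSum l (suc k) (suc r)

-- The last pebble starts in column `k + suc r`, to the right of the whole diagram. Moves only
-- increase its column, and lower rows are no longer than the first.
pebbleSum-beyond : ∀ {l} → Linked _≥_ l → ∀ k r → row l 1 < k ℕ.+ suc r → pebbleSum l k (suc r) ≡ 0
pebbleSum-beyond {[]}    _  k r _ = refl
pebbleSum-beyond {x ∷ l} l↘ k r x<k+r =
  cong₂ ℕ._+_ (first r x<k+r)
    (pebbleSum-beyond (Linked.tail l↘) (suc k) r (m<n⇒m<1+n (≤-<-trans (row-suc-≤ l↘ 0) x<k+r)))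
  where
  first : ∀ r → x < k ℕ.+ suc r →
          (if k <ᵇ x then hook (x ∷ l) (1 , suc k) ℕ.* pebbleSum (x ∷ l) (suc k) r else 0) ≡ 0
  first zero x<k+1
    rewrite ≤⇒<ᵇ≡false {k} {x} (ℕ.s≤s⁻¹ (subst (x <_) (+-comm k 1) x<k+1)) = refl
  first (suc r) x<k+r
    rewrite pebbleSum-beyond l↘ (suc k) r (subst (x <_) (+-suc k (suc r)) x<k+r)
    = if-*0 (k <ᵇ x) (hook (x ∷ l) (1 , suc k))
    where
    if-*0 : ∀ b h → (if b then h ℕ.* 0 else 0) ≡ 0
    if-*0 false h = refl
    if-*0 true  h = *-zeroʳ h

pebbleSum-head : ∀ {x} l {k} r → k < x →
         + pebbleSum (x ∷ l) k (suc r) ≡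
         + hook (x ∷ l) (1 , suc k) * + pebbleSum (x ∷ l) (suc k) r + + pebbleSum l (suc k) (suc r)
pebbleSum-head {x} l {k} r k<x =
  trans (cong (λ z → + (z ℕ.+ pebbleSum l (suc k) (suc r))) (if-true k<x))
        (cong (_+ + pebbleSum l (suc k) (suc r)) (ℤₚ.pos-* (hook (x ∷ l) (1 , suc k)) (pebbleSum (x ∷ l) (suc k) r)))
  where
  if-true : ∀ {k x h} → k < x → (if k <ᵇ x then h else 0) ≡ h
  if-true {k} {x} k<x with true ← k <ᵇ x | _ ← <⇒<ᵇ k<x = refl

-- ∑ r ≤ n, pebbleSum l k r ∏ k + r ≤ p < k + n, (u - p), in Horner form
genPoly : ℤ → List ℕ → ℕ → ℕ → ℤ
genPoly u l k zero    = 1ℤ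
genPoly u l k (suc n) = genPoly u l k n * (u - + (k ℕ.+ n)) + + pebbleSum l k (suc n)

-- The right side of the identity, restricted to the columns `k + 1`, ..., `k + n`; the factor of
-- column `i + 1` has the root `i - col l (suc i)`.
colPoly : ℤ → List ℕ → ℕ → ℕ → ℤ
colPoly u l k zero    = 1ℤ
colPoly u l k (suc n) = (u + + col l (suc k) - + k) * colPoly u l (suc k) n

colPoly-last : ∀ u l k n → colPoly u l k (suc n) ≡ colPoly u l k n * (u + + col l (suc (k ℕ.+ n)) - + (k ℕ.+ n))
colPoly-last u l k zero rewrite +-identityʳ k = ℤₚ.*-comm (u + + col l (suc k) - + k) 1ℤ
colPoly-last u l k (suc n)
  rewrite colPoly-last u l (suc k) n | +-suc k n = sym (ℤₚ.*-assoc (u + + col l (suc k) - + k) (colPoly u l (suc k) n)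
               (u + + col l (suc (suc (k ℕ.+ n))) - + suc (k ℕ.+ n)))

-- A new first row that spans all these columns lengthens each of them by one, which absorbs the
-- shift of `u`.
colPoly-tail : ∀ u {x} l k n → k ℕ.+ n ≤ x → colPoly (u + 1ℤ) l k n ≡ colPoly u (x ∷ l) k n
colPoly-tail u l k zero _ = refl
colPoly-tail u {x} l k (suc n) k+n<x =
  cong₂ _*_ factor (colPoly-tail u l (suc k) n (subst (_≤ x) (+-suc k n) k+n<x))
  where
  shift : ∀ u c k → u + 1ℤ + c - k ≡ u + (1ℤ + c) - k
  shift = solve-∀
  factor : u + 1ℤ + + col l (suc k) - + k ≡ u + + col (x ∷ l) (suc k) - + k
  factor rewrite <⇒𝟙≡1 (≤-trans (subst (suc k ≤_) (sym (+-suc k n)) (m≤m+n (suc k) n)) k+n<x)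
    = shift u (+ col l (suc k)) (+ k)

-- The two branches of `pebbleSum`, summed separately. If the first pebble rests, its hook factors
-- out. If all have moved, writing `u - p` as `(u + 1) - (p + 1)` turns the sum into
-- `genPoly (u + 1ℤ) l (suc k) (suc n)`, which appears here with one Horner step unfolded.
genPoly-head : ∀ u {x} l k n → k < x →
         genPoly u (x ∷ l) k (suc n) ≡
         + hook (x ∷ l) (1 , suc k) * genPoly u (x ∷ l) (suc k) n
         + genPoly (u + 1ℤ) l (suc k) n * (u - + (k ℕ.+ n)) + + pebbleSum l (suc k) (suc n)
genPoly-head u {x} l k zero k<x =
  trans (cong (λ z → 1ℤ * (u - + (k ℕ.+ 0)) + z) (pebbleSum-head l 0 k<x))
        (swap (u - + (k ℕ.+ 0)) (+ hook (x ∷ l) (1 , suc k)) (+ pebbleSum l (suc k) 1))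
  where
  swap : ∀ d h s → 1ℤ * d + (h * 1ℤ + s) ≡ h * 1ℤ + 1ℤ * d + s
  swap = solve-∀
genPoly-head u {x} l k (suc n) k<x rewrite +-suc k n =
  trans (cong₂ (λ t s → t * (u - + suc (k ℕ.+ n)) + s) (genPoly-head u l k n k<x) (pebbleSum-head l (suc n) k<x))
        (regroup u (+ (k ℕ.+ n)) (+ hook (x ∷ l) (1 , suc k)) (genPoly u (x ∷ l) (suc k) n)
          (genPoly (u + 1ℤ) l (suc k) n) (+ pebbleSum l (suc k) (suc n)) (+ pebbleSum (x ∷ l) (suc k) (suc n))
          (+ pebbleSum l (suc k) (suc (suc n))))
  where
  regroup : ∀ u p h t t′ s a b →
    (h * t + t′ * (u - p) + s) * (u - (1ℤ + p)) + (h * a + b) ≡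
    h * (t * (u - (1ℤ + p)) + a) + (t′ * (u + 1ℤ - (1ℤ + p)) + s) * (u - (1ℤ + p)) + b
  regroup = solve-∀

hook-first : ∀ l k n → hook (k ℕ.+ suc n ∷ l) (1 , suc k) ≡ suc n ℕ.+ col l (suc k)
hook-first l k n
  rewrite <⇒𝟙≡1 {k} {k ℕ.+ suc n} (m<m+n k (s≤s (z≤n {n}))) | +-suc k n | m+n∸m≡n k n
  = +-comm (n ℕ.+ col l (suc k)) 1

genPoly≡colPoly : ∀ u {l} → Linked _≥_ l → ∀ k n → row l 1 ≤ k ℕ.+ n → genPoly u l k n ≡ colPoly u l k n
genPoly≡colPoly u _ k zero _ = refl
genPoly≡colPoly u {[]} l↘ k (suc n) _
  rewrite colPoly-last u [] k n | genPoly≡colPoly u [] k n z≤n = drop (colPoly u [] k n) u (+ (k ℕ.+ n))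
  where
  drop : ∀ r u p → r * (u - p) + 0ℤ ≡ r * (u + 0ℤ - p)
  drop = solve-∀
genPoly≡colPoly u {x ∷ l} l↘ k (suc n) x≤k+n with m≤n⇒m<n∨m≡n x≤k+n
-- Column `k + n + 1` is empty and `suc n` pebbles do not fit, so both sides just gain the factor
-- `u - (k + n)`.
... | inj₁ x<k+n
  rewrite pebbleSum-beyond l↘ k n x<k+n | colPoly-last u (x ∷ l) k n
        | genPoly≡colPoly u l↘ k n (ℕ.s≤s⁻¹ (subst (x <_) (+-suc k n) x<k+n))
        | col-beyond l↘ (ℕ.s≤s⁻¹ (subst (x <_) (+-suc k n) x<k+n))
  = drop (colPoly u (x ∷ l) k n) u (+ (k ℕ.+ n))
  where
  drop : ∀ r u p → r * (u - p) + 0ℤ ≡ r * (u + 0ℤ - p)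
  drop = solve-∀
-- The first row ends exactly in column `k + n + 1`. By induction both polynomials in `genPoly-head`
-- equal the same `colPoly u (x ∷ l) (suc k) n`, the second one through `colPoly-tail`. Its
-- coefficients, the hook `1 + n + c` and `u - (k + n)`, add up to the missing factor
-- `u + (1 + c) - k`.
... | inj₂ refl
  rewrite genPoly-head u l k n (m<m+n k (s≤s (z≤n {n})))
        | hook-first l k n
        | genPoly≡colPoly u l↘ (suc k) n (≤-reflexive (+-suc k n))
        | genPoly≡colPoly (u + 1ℤ) (Linked.tail l↘) (suc k) n (≤-trans (row-suc-≤ l↘ 0) (≤-reflexive (+-suc k n)))
        | colPoly-tail u {k ℕ.+ suc n} l (suc k) n (≤-reflexive (sym (+-suc k n)))
        | pebbleSum-beyond (Linked.tail l↘) (suc k) n (s≤s (row-suc-≤ l↘ 0))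
        | <⇒𝟙≡1 {k} {k ℕ.+ suc n} (m<m+n k (s≤s (z≤n {n})))
  = collect u (+ k) (+ n) (+ col l (suc k)) (colPoly u (k ℕ.+ suc n ∷ l) (suc k) n)
  where
  collect : ∀ u k n c r → (1ℤ + (n + c)) * r + r * (u - (k + n)) + 0ℤ ≡ (u + (1ℤ + c) - k) * r
  collect = solve-∀

genPoly-cong : ∀ u {l l′} → (∀ r → pebbleSum l 0 r ≡ pebbleSum l′ 0 r) → ∀ n → genPoly u l 0 n ≡ genPoly u l′ 0 n
genPoly-cong u S≡ zero    = refl
genPoly-cong u S≡ (suc n) = cong₂ (λ t s → t * (u - + n) + + s) (genPoly-cong u S≡ n) (S≡ (suc n))

-- Recovering the column lengths from the roots

colPoly-zero⇒root : ∀ u l k n → colPoly u l k n ≡ 0ℤ → ∃[ j ] u + + col l (suc j) - + j ≡ 0ℤ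
colPoly-zero⇒root u l k (suc n) R≡0
  with ℤₚ.i*j≡0⇒i≡0∨j≡0 (u + + col l (suc k) - + k) R≡0
... | inj₁ ≡0 = k , ≡0
... | inj₂ ≡0 = colPoly-zero⇒root u l (suc k) n ≡0

root⇒colPoly-zero : ∀ u l k n {i} → k ≤ i → i < k ℕ.+ n → u + + col l (suc i) - + i ≡ 0ℤ → colPoly u l k n ≡ 0ℤ
root⇒colPoly-zero u l k zero k≤i i<k+0 _ = contradiction (subst (_ <_) (+-identityʳ k) i<k+0) (≤⇒≯ k≤i)
root⇒colPoly-zero u l k (suc n) {i} k≤i i<k+n ≡0 with m≤n⇒m<n∨m≡n k≤i
... | inj₂ refl rewrite ≡0 = refl
... | inj₁ k<i
  rewrite root⇒colPoly-zero u l (suc k) n k<i (subst (i <_) (+-suc k n) i<k+n) ≡0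
  = ℤₚ.*-zeroʳ (u + + col l (suc k) - + k)

-- Evaluate at the root `i - col l (suc i)` of the first product: some factor of the second must
-- vanish there. The equality of the two roots is stated without subtraction, in ℕ.
common-root : ∀ {l l′} n → (∀ u → colPoly u l 0 n ≡ colPoly u l′ 0 n) →
              ∀ {i} → i < n → ∃[ j ] i ℕ.+ col l′ (suc j) ≡ j ℕ.+ col l (suc i)
common-root {l} {l′} n R≡ {i} i<n =
  let u = + i - + col l (suc i)
      j , ≡0 = colPoly-zero⇒root u l′ 0 n
        (trans (sym (R≡ u)) (root⇒colPoly-zero u l 0 n z≤n i<n (root (+ i) (+ col l (suc i)))))
  in j , ℤₚ.+-injective (ℤₚ.i-j≡0⇒i≡j _ _ (trans (rearrange (+ i) (+ col l (suc i)) (+ col l′ (suc j)) (+ j)) ≡0))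
  where
  root : ∀ i c → i - c + c - i ≡ 0ℤ
  root = solve-∀
  rearrange : ∀ i c d j → (i + d) - (j + c) ≡ i - c + d - j
  rearrange = solve-∀

-- The numbers i - c i are strictly increasing, so they are determined by the set they form.
antitone-determined : ∀ {c d : ℕ → ℕ} {n} →
  (∀ {i j} → i ≤ j → c j ≤ c i) → (∀ {i j} → i ≤ j → d j ≤ d i) →
  (∀ {i} → i < n → ∃[ j ] i ℕ.+ d j ≡ j ℕ.+ c i) →
  (∀ {i} → i < n → ∃[ j ] i ℕ.+ c j ≡ j ℕ.+ d i) →
  ∀ i → i < n → c i ≡ d i
antitone-determined {c} {d} {n} c↘ d↘ c⊆d d⊆c = <-rec (λ i → i < n → c i ≡ d i) step
  where
  -- The given `j` satisfies `i - c i = j - d j`. If `j < i`, then `d j = c j ≥ c i` makes the right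
  -- side smaller than the left. If `i ≤ j`, then `d j ≤ d i` gives `c i ≤ d i`.
  ≤-from : ∀ c d → (∀ {i j} → i ≤ j → c j ≤ c i) → (∀ {i j} → i ≤ j → d j ≤ d i) →
           ∀ i → (∀ {j} → j < i → c j ≡ d j) → ∃[ j ] i ℕ.+ d j ≡ j ℕ.+ c i → c i ≤ d i
  ≤-from c d c↘ d↘ i below (j , eq) with <-≤-connex j i
  ... | inj₁ j<i = contradiction eq (>⇒≢ (+-mono-<-≤ j<i (subst (c i ≤_) (below j<i) (c↘ (<⇒≤ j<i)))))
  ... | inj₂ i≤j = +-cancelˡ-≤ j (c i) (d i) (subst (_≤ j ℕ.+ d i) eq (+-mono-≤ i≤j (d↘ i≤j)))

  step : ∀ i → (∀ {j} → j < i → j < n → c j ≡ d j) → i < n → c i ≡ d i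
  step i rec i<n = ≤-antisym
    (≤-from c d c↘ d↘ i (λ j<i → rec j<i (<-trans j<i i<n)) (c⊆d i<n))
    (≤-from d c d↘ c↘ i (λ j<i → sym (rec j<i (<-trans j<i i<n))) (d⊆c i<n))

-- Otherwise column `x` would be empty in the second diagram, but it meets the first row of the
-- first one.
head-≤ : ∀ {x y l l′} → Linked _≥_ (y ∷ l′) → 0 < x →
         (∀ j → col (x ∷ l) (suc j) ≡ col (y ∷ l′) (suc j)) → x ≤ y
head-≤ {suc x} {y} {l} l′↘ _ col≡ with <-≤-connex x y
... | inj₁ x<y = x<y
... | inj₂ y≤x
  with () ← trans (sym (trans (col≡ x) (col-beyond l′↘ y≤x))) (cong (ℕ._+ col l (suc x)) (<⇒𝟙≡1 (n<1+n x)))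

col-injective : ∀ {l l′} → Linked _≥_ l → Linked _≥_ l′ → All (0 <_) l → All (0 <_) l′ →
                (∀ j → col l (suc j) ≡ col l′ (suc j)) → l ≡ l′
col-injective {[]} {[]} _ _ _ _ _ = refl
col-injective {[]} {y ∷ _} _ _ _ (0<y ∷ _) col≡ with () ← trans (col≡ 0) (cong (ℕ._+ _) (<⇒𝟙≡1 0<y))
col-injective {x ∷ _} {[]} _ _ (0<x ∷ _) _ col≡ with () ← trans (sym (col≡ 0)) (cong (ℕ._+ _) (<⇒𝟙≡1 0<x))
col-injective {x ∷ l} {y ∷ l′} l↘ l′↘ (0<x ∷ 0<l) (0<y ∷ 0<l′) col≡
  with refl ← ≤-antisym (head-≤ {l = l} l′↘ 0<x col≡) (head-≤ {l = l′} l↘ 0<y (λ j → sym (col≡ j))) =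
  cong (x ∷_) (col-injective (Linked.tail l↘) (Linked.tail l′↘) 0<l 0<l′
    (λ j → +-cancelˡ-≡ 𝟙[ j < x ] _ _ (col≡ j)))

pebbleSum-determines : ∀ {l l′} → Linked _≥_ l → Linked _≥_ l′ → All (0 <_) l → All (0 <_) l′ →
               (∀ r → pebbleSum l 0 r ≡ pebbleSum l′ 0 r) → l ≡ l′
pebbleSum-determines {l} {l′} l↘ l′↘ 0<l 0<l′ S≡ = col-injective l↘ l′↘ 0<l 0<l′ col≡
  where
  -- One `n` that covers both diagrams, so that the identity applies to each; columns after `n` are
  -- empty in both.
  n = row l 1 ⊔ row l′ 1
  R≡ : ∀ u → colPoly u l 0 n ≡ colPoly u l′ 0 n
  R≡ u = trans (sym (genPoly≡colPoly u l↘ 0 n (m≤m⊔n _ _)))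
        (trans (genPoly-cong u S≡ n) (genPoly≡colPoly u l′↘ 0 n (m≤n⊔m (row l 1) _)))
  col≡ : ∀ j → col l (suc j) ≡ col l′ (suc j)
  col≡ j with <-≤-connex j n
  ... | inj₁ j<n = antitone-determined {λ i → col l (suc i)} {λ i → col l′ (suc i)} {n}
                     (col-antitone l) (col-antitone l′) (common-root {l} {l′} n R≡)
                     (common-root {l′} {l} n (λ u → sym (R≡ u))) j j<n
  ... | inj₂ n≤j = trans (col-beyond l↘ (≤-trans (m≤m⊔n _ _) n≤j))
                    (sym (col-beyond l′↘ (≤-trans (m≤n⊔m (row l 1) _) n≤j)))

-- Pebble configurations

T-not⁺ : ∀ {b} → ¬ T b → T (not b)
T-not⁺ {false} _  = _
T-not⁺ {true}  ¬b = ¬b _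

T-not⁻ : ∀ {b} → T (not b) → ¬ T b
T-not⁻ {false} _ ()

In : List ℕ → Cell → Set
In l c = T (inDiagram l c)

↘ : Cell → Cell
↘ (i , j) = suc i , suc j

occ⁺ : ∀ {c x} → x ∈ c → T (occ c x)
occ⁺ {x = x} x∈c = Any.any⁺ (cellEq x)
  (lose x∈c (Equivalence.from T-∧ (≡⇒≡ᵇ (proj₁ x) _ refl , ≡⇒≡ᵇ (proj₂ x) _ refl)))

occ⁻ : ∀ {c x} → T (occ c x) → x ∈ c
occ⁻ {c} {x} = Any.map cellEq⇒≡ ∘ Any.any⁻ (cellEq x) c
  where
  cellEq⇒≡ : ∀ {x y} → T (cellEq x y) → x ≡ y
  cellEq⇒≡ {i , j} {i′ , j′} eq =
    let i≡ , j≡ = Equivalence.to (T-∧ {i ≡ᵇ i′}) eq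
    in cong₂ _,_ (≡ᵇ⇒≡ i i′ i≡) (≡ᵇ⇒≡ j j′ j≡)

sameSet-refl : ∀ c → T (sameSet c c)
sameSet-refl c = Equivalence.from T-∧ (occ-self , occ-self)
  where
  occ-self : T (all (occ c) c)
  occ-self = All.all⁻ (occ c) (All.tabulate (occ⁺ {c}))

sameSet⇒⊆ : ∀ c d → T (sameSet c d) → All (_∈ d) c
sameSet⇒⊆ c d eq = All.map (occ⁻ {d}) (All.all⁺ (occ d) c (proj₁ (Equivalence.to T-∧ eq)))

canMove⁺ : ∀ {l c i j} → (i , suc j) ∉ c → (suc i , j) ∉ c → (suc i , suc j) ∉ c →
           In l (suc i , suc j) → T (canMove l c (i , j))
canMove⁺ {c = c} ∉₁ ∉₂ ∉₃ in-l = Equivalence.from T-∧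
  (T-not⁺ (∉₁ ∘ occ⁻ {c}) , Equivalence.from T-∧
  (T-not⁺ (∉₂ ∘ occ⁻ {c}) , Equivalence.from T-∧
  (T-not⁺ (∉₃ ∘ occ⁻ {c}) , in-l)))

canMove⁻ : ∀ {l c i j} → T (canMove l c (i , j)) → (i , suc j) ∉ c × In l (suc i , suc j)
canMove⁻ {l} {c} {i} {j} can =
  let free , can′ = Equivalence.to (T-∧ {not (occ c (i , suc j))}) can
      _ , can″    = Equivalence.to (T-∧ {not (occ c (suc i , j))}) can′
      _ , in-l    = Equivalence.to (T-∧ {not (occ c (suc i , suc j))}) can″
  in T-not⁻ free ∘ occ⁺ , in-l

-- `moves` is the local function `go` of `movesFrom`; it has no name outside Defs, so it is
-- solved for by unification with the unfolding of `movesFrom`. The constructors below are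
-- qualified because overloaded ones would be resolved too late for the abstraction.
mutual
  moves : List ℕ → Config → Config → Config → List Config
  moves = _

  movesFrom-∷ : ∀ l x c → movesFrom l (x ∷ c) ≡
                (if canMove l (x ∷ c) x then (↘ x ∷ c) ∷ [] else []) ++ moves l (x ∷ c) (x ∷ []) c
  movesFrom-∷ l x c with List._∷_ x c | List._∷_ x List.[]
  ... | _ | _ = refl

movesFrom≡moves : ∀ l c → movesFrom l c ≡ moves l c [] c
movesFrom≡moves l []      = refl
movesFrom≡moves l (x ∷ c) = movesFrom-∷ l x c

if-∈⁻ : ∀ {A : Set} b {x y : A} → x ∈ (if b then y ∷ [] else []) → T b × x ≡ y
if-∈⁻ true (here eq) = _ , eq

if-∈⁺ : ∀ {A : Set} b {x : A} → T b → x ∈ (if b then x ∷ [] else [])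
if-∈⁺ true _ = here refl

-- `b` collects the pebbles already scanned and `d` holds those to come, while legality is always
-- tested against the fixed `c`. Hence `c` stays put in the induction as `b` grows.
moves-∈⁻ : ∀ l c b d {y} → y ∈ moves l c b d →
           ∃[ p ] ∃[ x ] ∃[ q ] d ≡ p ++ x ∷ q × T (canMove l c x) × y ≡ b ++ p ++ ↘ x ∷ q
moves-∈⁻ l c b (x ∷ d) y∈ with ∈-++⁻ (if canMove l c x then (b ++ ↘ x ∷ d) ∷ [] else []) y∈
... | inj₁ y∈ = let can , y≡ = if-∈⁻ (canMove l c x) y∈ in [] , x , d , refl , can , y≡
... | inj₂ y∈ =
  let p , z , q , d≡ , can , y≡ = moves-∈⁻ l c (b ++ x ∷ []) d y∈
  in x ∷ p , z , q , cong (x ∷_) d≡ , can , trans y≡ (++-assoc b (x ∷ []) _)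

moves-∈⁺ : ∀ l c b p {x q} → T (canMove l c x) → b ++ p ++ ↘ x ∷ q ∈ moves l c b (p ++ x ∷ q)
moves-∈⁺ l c b []      {x} can = ∈-++⁺ˡ (if-∈⁺ (canMove l c x) can)
moves-∈⁺ l c b (z ∷ p) {x} {q} can = ∈-++⁺ʳ (if canMove l c z then (b ++ ↘ z ∷ p ++ x ∷ q) ∷ [] else [])
  (subst (_∈ moves l c (b ++ z ∷ []) (p ++ x ∷ q)) (++-assoc b (z ∷ []) _) (moves-∈⁺ l c (b ++ z ∷ []) p can))

movesFrom-∈⁻ : ∀ l c {y} → y ∈ movesFrom l c →
               ∃[ p ] ∃[ x ] ∃[ q ] c ≡ p ++ x ∷ q × T (canMove l c x) × y ≡ p ++ ↘ x ∷ q
movesFrom-∈⁻ l c y∈ = moves-∈⁻ l c [] c (subst (_ ∈_) (movesFrom≡moves l c) y∈)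

movesFrom-∈⁺ : ∀ l p {x q} → T (canMove l (p ++ x ∷ q) x) → p ++ ↘ x ∷ q ∈ movesFrom l (p ++ x ∷ q)
movesFrom-∈⁺ l p {x} {q} can =
  subst (_ ∈_) (sym (movesFrom≡moves l (p ++ x ∷ q))) (moves-∈⁺ l (p ++ x ∷ q) [] p can)

-- Deduplication and reachability

dedup-∈⁻ : ∀ cs {c} → c ∈ dedup cs → c ∈ cs
dedup-∈⁻ (d ∷ cs) (here c≡d)  = here c≡d
dedup-∈⁻ (d ∷ cs) (there c∈) = there (dedup-∈⁻ cs (proj₁ (∈-filter⁻ (T? ∘ not ∘ sameSet d) c∈)))

dedup-unique : ∀ cs → Unique (dedup cs)
dedup-unique []       = []
dedup-unique (c ∷ cs) =
  All.map (λ where ¬same refl → T-not⁻ ¬same (sameSet-refl c)) (All.all-filter (T? ∘ not ∘ sameSet c) (dedup cs))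
  ∷ Unique.filter⁺ (T? ∘ not ∘ sameSet c) (dedup-unique cs)

-- Among configurations with such a property `P`, `dedup` discards only literal repetitions, so
-- membership survives it.
SameSet⇒≡ : (Config → Set) → Set
SameSet⇒≡ P = ∀ {c d} → P c → P d → T (sameSet c d) → c ≡ d

dedup-∈⁺ : ∀ {P} → SameSet⇒≡ P → ∀ {cs} → All P cs → ∀ {c} → c ∈ cs → c ∈ dedup cs
dedup-∈⁺ same⇒≡ (_ ∷ _) (here c≡) = here c≡
dedup-∈⁺ same⇒≡ {d ∷ cs} (pd ∷ pcs) {c} (there c∈) with T? (sameSet d c)
... | yes same = here (sym (same⇒≡ pd (All.lookup pcs c∈) same))
... | no ¬same = there (∈-filter⁺ (T? ∘ not ∘ sameSet d) (dedup-∈⁺ same⇒≡ pcs c∈) (T-not⁺ ¬same))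

module Reach (l : List ℕ) (P : Config → Set) (same⇒≡ : SameSet⇒≡ P)
             (P-move : ∀ {c d} → P c → d ∈ movesFrom l c → P d) where

  after : List Config → List Config
  after cs = cs ++ concatMap (movesFrom l) cs

  after-P : ∀ {cs} → All P cs → All P (after cs)
  after-P {cs} pcs = All.++⁺ pcs (All.tabulate λ d∈ →
    let c , c∈ , d∈′ = find∈ d∈ in P-move (All.lookup pcs c∈) d∈′)
    where
    find∈ : ∀ {d} → d ∈ concatMap (movesFrom l) cs → ∃[ c ] c ∈ cs × d ∈ movesFrom l c
    find∈ d∈ = find (∈-concatMap⁻ (movesFrom l) {xs = cs} d∈)

  step-P : ∀ {cs} → All P cs → All P (dedup (after cs))
  step-P {cs} pcs = All.tabulate (All.lookup (after-P pcs) ∘ dedup-∈⁻ (after cs))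

  reach-P : ∀ n {cs} → All P cs → All P (reachWithin l n cs)
  reach-P zero    {cs} pcs = All.tabulate (All.lookup pcs ∘ dedup-∈⁻ cs)
  reach-P (suc n) pcs = reach-P n (step-P pcs)

  -- `reachWithin` runs its rounds from the starting list onward, so the additional last round is
  -- exposed only at `n = 0`, after the induction has consumed the earlier ones. A round keeps old
  -- configurations, hence the alternative `d ≡ c`.
  reach-move : ∀ n {cs} → All P cs → ∀ {c d} → c ∈ reachWithin l n cs → d ≡ c ⊎ d ∈ movesFrom l c →
               d ∈ reachWithin l (suc n) cs
  reach-move (suc n) pcs c∈ d = reach-move n (step-P pcs) c∈ d
  reach-move zero {cs} pcs {c} {d} c∈ d↝ =
    dedup-∈⁺ same⇒≡ (step-P pcs) (dedup-∈⁺ same⇒≡ (after-P pcs) (d∈after d↝))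
    where
    d∈after : d ≡ c ⊎ d ∈ movesFrom l c → d ∈ after cs
    d∈after (inj₁ refl) = ∈-++⁺ˡ (dedup-∈⁻ cs c∈)
    d∈after (inj₂ d∈)   = ∈-++⁺ʳ cs (∈-concatMap⁺ (movesFrom l) (lose (dedup-∈⁻ cs c∈) d∈))

reach-unique : ∀ l n cs → Unique (reachWithin l n cs)
reach-unique l zero    cs = dedup-unique cs
reach-unique l (suc n) cs = reach-unique l n _

-- Pebble number j, counted from zero, starts in the cell (1, k + 1 + j) and has moved a_j times.
config : ℕ → List ℕ → Config
config k []      = []
config k (v ∷ a) = (suc v , suc (v ℕ.+ k)) ∷ config (suc k) a

-- The encoding of configurations by move counts

config-++ : ∀ k a b → config k (a ++ b) ≡ config k a ++ config (length a ℕ.+ k) b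
config-++ k []      b = refl
config-++ k (v ∷ a) b =
  cong (_ ∷_) (trans (config-++ (suc k) a b)
    (cong (λ n → config (suc k) a ++ config n b) (+-suc (length a) k)))

config-split : ∀ k a p {x q} → config k a ≡ p ++ x ∷ q →
               ∃[ a₁ ] ∃[ v ] ∃[ a₂ ] a ≡ a₁ ++ v ∷ a₂ × p ≡ config k a₁
               × x ≡ (suc v , suc (v ℕ.+ (length a₁ ℕ.+ k))) × q ≡ config (suc (length a₁ ℕ.+ k)) a₂
config-split k (v ∷ a) [] refl = [] , v , a , refl , refl , refl , refl
config-split k (v ∷ a) (z ∷ p) eq with refl , eq′ ← ∷-injective eq
  with a₁ , w , a₂ , refl , p≡ , x≡ , q≡ ← config-split (suc k) a p eq′
  rewrite +-suc (length a₁) k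
  = v ∷ a₁ , w , a₂ , refl , cong (_ ∷_) p≡ , x≡ , q≡

-- Moves preserve column minus row, so the pebbles of `config k a` stand on the diagonals `k`,
-- `k + 1`, ..., one on each. Here `d` is the diagonal of `x`.
∈-config : ∀ {k} a {x} → x ∈ config k a → ∃[ d ] ∃[ v ] x ≡ (suc v , suc (v ℕ.+ d)) × k ≤ d
∈-config {k} (v ∷ a) (here x≡) = k , v , x≡ , ≤-refl
∈-config {k} (v ∷ a) (there x∈) =
  let d , w , x≡ , k<d = ∈-config a x∈ in d , w , x≡ , <⇒≤ k<d

∈-config-diagonal : ∀ {k} a {d v} → (suc v , suc (v ℕ.+ d)) ∈ config k a → k ≤ d
∈-config-diagonal {k} a {d} {v} x∈ with e , w , eq , k≤e ← ∈-config a x∈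
  with refl ← suc-injective (,-injectiveˡ eq)
  = subst (k ≤_) (+-cancelˡ-≡ v e d (suc-injective (sym (,-injectiveʳ eq)))) k≤e

∈-config-head : ∀ {k u} b {v} → (suc v , suc (v ℕ.+ k)) ∈ config k (u ∷ b) → v ≡ u
∈-config-head b (here eq)  = suc-injective (,-injectiveˡ eq)
∈-config-head b (there x∈) = contradiction (∈-config-diagonal b x∈) 1+n≰n

∈-config-zeros : ∀ {k} i b {x} → x ∈ config k (replicate i 0 ++ b) →
                 x ∈ config (i ℕ.+ k) b ⊎ proj₁ x ≡ 1 × proj₂ x ≤ i ℕ.+ k
∈-config-zeros zero b x∈ = inj₁ x∈
∈-config-zeros {k} (suc i) b (here refl) = inj₂ (refl , s≤s (m≤n+m k i))
∈-config-zeros {k} (suc i) b (there x∈) rewrite sym (+-suc i k) = ∈-config-zeros i b x∈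

-- Only the first pebble of each side is on diagonal `k`, so the first counts agree. The other
-- pebbles are on later diagonals, and the inclusion passes to the tails.
config-⊆⇒≡ : ∀ k a b → length a ≡ length b → All (_∈ config k b) (config k a) → a ≡ b
config-⊆⇒≡ k []      []      _   _ = refl
config-⊆⇒≡ k (v ∷ a) (u ∷ b) len (x∈ ∷ a⊆) =
  cong₂ _∷_ (∈-config-head b x∈)
    (config-⊆⇒≡ (suc k) a b (suc-injective len) (All.tabulate drop-head))
  where
  drop-head : ∀ {x} → x ∈ config (suc k) a → x ∈ config (suc k) b
  drop-head x∈a with All.lookup a⊆ x∈a
  ... | there x∈b = x∈b
  ... | here refl = contradiction (∈-config-diagonal a x∈a) 1+n≰n

config-injective : ∀ k {a b} → config k a ≡ config k b → a ≡ b
config-injective k {[]}    {[]}    _ = refl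
config-injective k {v ∷ a} {u ∷ b} eq with eq₁ , eq₂ ← ∷-injective eq =
  cong₂ _∷_ (suc-injective (,-injectiveˡ eq₁)) (config-injective (suc k) eq₂)

config-map-suc : ∀ k a → config k (map suc a) ≡ map (λ (i , j) → suc i , j) (config (suc k) a)
config-map-suc k []      = refl
config-map-suc k (v ∷ a) =
  cong₂ _∷_ (cong (λ j → suc (suc v) , suc j) (sym (+-suc v k))) (config-map-suc (suc k) a)

-- Placements are exactly the reachable configurations

record Placement (l : List ℕ) (k r : ℕ) (a : List ℕ) : Set where
  constructor placement
  field
    size   : length a ≡ r
    sorted : Linked _≤_ a
    inside : All (In l) (config k a)
open Placement

IsPlacement : List ℕ → ℕ → Config → Set
IsPlacement l m c = ∃[ a ] c ≡ config 0 a × Placement l 0 m a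

IsPlacement-sameSet : ∀ l m → SameSet⇒≡ (IsPlacement l m)
IsPlacement-sameSet l m (a , refl , pa) (b , refl , pb) same =
  cong (config 0) (config-⊆⇒≡ 0 a b (trans (size pa) (sym (size pb)))
    (sameSet⇒⊆ (config 0 a) (config 0 b) same))

Linked-replace : ∀ a {v w b} → Linked _≤_ (a ++ v ∷ b) → v ≤ w → Linked _≤_ (w ∷ b) →
                 Linked _≤_ (a ++ w ∷ b)
Linked-replace []          _          v≤w wb = wb
Linked-replace (x ∷ [])    (x≤v ∷ _)  v≤w wb = ≤-trans x≤v v≤w ∷ wb
Linked-replace (x ∷ y ∷ a) (x≤y ∷ ab) v≤w wb = x≤y ∷ Linked-replace (y ∷ a) ab v≤w wb

config-replace : ∀ {P : Cell → Set} k a {v w b} → All P (config k (a ++ v ∷ b)) →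
                 P (suc w , suc (w ℕ.+ (length a ℕ.+ k))) → All P (config k (a ++ w ∷ b))
config-replace k a {v} {w} {b} all pw
  rewrite config-++ k a (v ∷ b) | config-++ k a (w ∷ b)
  with pa , _ ∷ pb ← All.++⁻ (config k a) all
  = All.++⁺ pa (pw ∷ pb)

length-replace : ∀ a {v w : ℕ} {b} → length (a ++ v ∷ b) ≡ length (a ++ w ∷ b)
length-replace []      = refl
length-replace (x ∷ a) = cong suc (length-replace a)

Linked-++⁻ʳ : ∀ a {b} → Linked _≤_ (a ++ b) → Linked _≤_ b
Linked-++⁻ʳ []      ab = ab
Linked-++⁻ʳ (x ∷ a) ab = Linked-++⁻ʳ a (Linked.tail ab)

-- Raising the count `v` could only break sortedness if the next count were also `v`. That pebble
-- would then occupy the cell to the right, which the move requires to be free.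
Placement-move : ∀ l m {c d} → IsPlacement l m c → d ∈ movesFrom l c → IsPlacement l m d
Placement-move l m (a , refl , pa) d∈
  with p , x , q , c≡ , can , refl ← movesFrom-∈⁻ l (config 0 a) d∈
  with a₁ , v , a₂ , refl , refl , refl , refl ← config-split 0 a p c≡
  with free , in-l ← canMove⁻ {l} {config 0 (a₁ ++ v ∷ a₂)} {suc v} can
  = a₁ ++ suc v ∷ a₂ , sym (config-++ 0 a₁ (suc v ∷ a₂)) , record
  { size   = trans (length-replace a₁) (size pa)
  ; sorted = Linked-replace a₁ (sorted pa) (n≤1+n v) (bump a₂ (Linked-++⁻ʳ a₁ (sorted pa))
      λ { _ b refl refl → free (right-∈ a₁ v b) })
  ; inside = config-replace 0 a₁ (inside pa) in-l
  }
  where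
  right-∈ : ∀ a v b → (suc v , suc (suc (v ℕ.+ (length a ℕ.+ 0)))) ∈ config 0 (a ++ v ∷ v ∷ b)
  right-∈ a v b rewrite config-++ 0 a (v ∷ v ∷ b) | sym (+-suc v (length a ℕ.+ 0)) =
    ∈-++⁺ʳ (config 0 a) (there (here refl))
  bump : ∀ {v} b → Linked _≤_ (v ∷ b) → (∀ u b′ → b ≡ u ∷ b′ → v ≢ u) → Linked _≤_ (suc v ∷ b)
  bump []      _           _   = [-]
  bump (u ∷ b) (v≤u ∷ vb) v≢u = ≤∧≢⇒< v≤u (v≢u u b refl) ∷ vb

zeros-or-moved : ∀ a → a ≡ replicate (length a) 0 ⊎ ∃[ i ] ∃[ v ] ∃[ b ] a ≡ replicate i 0 ++ suc v ∷ b
zeros-or-moved []          = inj₁ refl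
zeros-or-moved (suc v ∷ a) = inj₂ (0 , v , a , refl)
zeros-or-moved (zero ∷ a) with zeros-or-moved a
... | inj₁ a≡            = inj₁ (cong (0 ∷_) a≡)
... | inj₂ (i , v , b , a≡) = inj₂ (suc i , v , b , cong (0 ∷_) a≡)

Linked-zeros : ∀ i {b} → Linked _≤_ b → Linked _≤_ (replicate i 0 ++ b)
Linked-zeros zero          lb = lb
Linked-zeros (suc zero) {[]}    lb = [-]
Linked-zeros (suc zero) {x ∷ b} lb = z≤n ∷ lb
Linked-zeros (suc (suc i)) lb = z≤n ∷ Linked-zeros (suc i) lb

sum-zeros-++ : ∀ i b → sum (replicate i 0 ++ b) ≡ sum b
sum-zeros-++ zero    b = refl
sum-zeros-++ (suc i) b = sum-zeros-++ i b

-- The first pebble that has moved can step back: its left neighbours are still in row 1.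
canMove-first : ∀ l i v b → Linked _≤_ (suc v ∷ b) → In l (suc (suc v) , suc (suc v ℕ.+ i)) →
                T (canMove l (config 0 (replicate i 0 ++ v ∷ b)) (suc v , suc (v ℕ.+ i)))
canMove-first l i v b vb in-l =
  canMove⁺ {l} {config 0 (replicate i 0 ++ v ∷ b)} (right ∘ cases) (below ∘ cases) (diagonal ∘ cases) in-l
  where
  cases : ∀ {x} → x ∈ config 0 (replicate i 0 ++ v ∷ b) →
          x ∈ config i (v ∷ b) ⊎ proj₁ x ≡ 1 × proj₂ x ≤ i
  cases x∈ = subst (λ n → _ ∈ config n (v ∷ b) ⊎ _ × _ ≤ n) (+-identityʳ i) (∈-config-zeros i (v ∷ b) x∈)
  right : ¬ ((suc v , suc (suc (v ℕ.+ i))) ∈ config i (v ∷ b) ⊎ suc v ≡ 1 × suc (suc (v ℕ.+ i)) ≤ i)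
  right (inj₂ (_ , le)) = m+n≮n (suc v) i le
  right (inj₁ (here eq)) = 1+n≢n (,-injectiveʳ eq)
  -- The cell is on the diagonal of the next pebble, so an occupant would have made `v` moves;
  -- sortedness gives that pebble at least `suc v`.
  right (inj₁ (there x∈)) =
    next b vb (subst (λ j → (suc v , suc j) ∈ config (suc i) b) (sym (+-suc v i)) x∈)
    where
    next : ∀ b → Linked _≤_ (suc v ∷ b) → (suc v , suc (v ℕ.+ suc i)) ∉ config (suc i) b
    next (u ∷ b) (v<u ∷ _) x∈ = <⇒≢ v<u (∈-config-head b x∈)
  below : ¬ ((suc (suc v) , suc (v ℕ.+ i)) ∈ config i (v ∷ b) ⊎ suc (suc v) ≡ 1 × suc (v ℕ.+ i) ≤ i)
  -- This cell is on diagonal `i - 1`, before those of all the pebbles in `config i (v ∷ b)`.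
  below (inj₁ x∈) with d , w , eq , i≤d ← ∈-config (v ∷ b) x∈
    with refl ← suc-injective (,-injectiveˡ eq)
    = <⇒≢ (s≤s (+-monoʳ-≤ v i≤d)) (suc-injective (,-injectiveʳ eq))
  diagonal : ¬ ((suc (suc v) , suc (suc v ℕ.+ i)) ∈ config i (v ∷ b) ⊎ suc (suc v) ≡ 1 × suc (suc v ℕ.+ i) ≤ i)
  diagonal (inj₁ x∈) = 1+n≢n (∈-config-head b x∈)

In⇒< : ∀ l {i j} → In l (suc i , suc j) → j < row l (suc i)
In⇒< l {i} {j} = <ᵇ⇒< j (row l (suc i))

<⇒In : ∀ l {i j} → j < row l (suc i) → In l (suc i , suc j)
<⇒In l = <⇒<ᵇ

module _ {l} (l↘ : Linked _≥_ l) (m : ℕ) where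
  open Reach l (IsPlacement l m) (IsPlacement-sameSet l m) (Placement-move l m)

  start : List Config
  start = config 0 (replicate m 0) ∷ []

  -- Induction on the number of rounds. Moving the first moved pebble back one step gives a
  -- placement with a sum smaller by one, from which a single legal move returns.
  reach-all : All (IsPlacement l m) start → ∀ n {a} → Placement l 0 m a → sum a ≤ n →
              config 0 a ∈ reachWithin l n start
  reach-all ps n {a} pa sum≤n with zeros-or-moved a
  reach-all ps zero pa sum≤n | inj₁ a≡ = here (cong (config 0) (trans a≡ (cong (λ n → replicate n 0) (size pa))))
  -- No pebble has moved: the starting configuration survives the round unchanged.
  reach-all ps (suc n) {a} pa sum≤n | inj₁ a≡ =
    reach-move n ps (reach-all ps n pa (subst (_≤ n) (sym sum≡0) z≤n)) (inj₁ refl)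
    where
    sum≡0 : sum a ≡ 0
    sum≡0 = trans (cong sum (trans a≡ (sym (++-identityʳ _)))) (sum-zeros-++ (length a) [])
  reach-all ps n pa sum≤n | inj₂ (i , v , b , refl) rewrite sum-zeros-++ i (suc v ∷ b) with n | sum≤n
  ... | suc n | s≤s sum≤n = reach-move n ps
    (reach-all ps n pa′ (subst (_≤ n) (sym (sum-zeros-++ i (v ∷ b))) sum≤n))
    (inj₂ (subst₂ (λ c d → d ∈ movesFrom l c) (sym (split v)) (sym (split (suc v)))
      (movesFrom-∈⁺ l (config 0 (replicate i 0)) {q = config (suc i) b}
        (subst (λ c → T (canMove l c _)) (split v) (canMove-first l i v b vb in-l)))))
    where
    offset : length (replicate i 0) ℕ.+ 0 ≡ i
    offset = trans (+-identityʳ _) (length-replicate i)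
    split : ∀ w → config 0 (replicate i 0 ++ w ∷ b) ≡
                  config 0 (replicate i 0) ++ (suc w , suc (w ℕ.+ i)) ∷ config (suc i) b
    split w = trans (config-++ 0 (replicate i 0) (w ∷ b))
      (cong (λ k → config 0 (replicate i 0) ++ config k (w ∷ b)) offset)
    vb : Linked _≤_ (suc v ∷ b)
    vb = Linked-++⁻ʳ (replicate i 0) (sorted pa)
    in-l : In l (suc (suc v) , suc (suc v ℕ.+ i))
    in-l = All.lookup (inside pa) (subst (_ ∈_) (sym (split (suc v)))
      (∈-++⁺ʳ (config 0 (replicate i 0)) (here refl)))
    pa′ : Placement l 0 m (replicate i 0 ++ v ∷ b)
    pa′ = record
      { size   = trans (length-replace (replicate i 0)) (size pa)
      ; sorted = Linked-zeros i (lower vb)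
      -- The cell stepped back to is one column to the left and one row up, where the row is at
      -- least as long.
      ; inside = config-replace 0 (replicate i 0) (inside pa)
          (<⇒In l (subst (λ k → v ℕ.+ k < row l (suc v)) (sym offset)
            (<-≤-trans (<-trans (n<1+n _) (In⇒< l {suc v} in-l)) (row-suc-≤ l↘ v))))
      }
      where
      lower : ∀ {b} → Linked _≤_ (suc v ∷ b) → Linked _≤_ (v ∷ b)
      lower [-]        = [-]
      lower (v≤u ∷ vb) = <⇒≤ v≤u ∷ vb

-- Hook sums over placements

-- Follows `pebbleSum` branch by branch: a sorted sequence starts with 0 or has only positive
-- entries.
placements : List ℕ → ℕ → ℕ → List (List ℕ)
placements l       k zero    = [] ∷ []
placements []      k (suc r) = []
placements (x ∷ l) k (suc r) =
  (if k <ᵇ x then map (0 ∷_) (placements (x ∷ l) (suc k) r) else [])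
  ++ map (map suc) (placements l (suc k) (suc r))

weight : List ℕ → Config → ℕ
weight l c = product (map (hook l) c)

-- Deleting the first row lowers row indices by one and keeps columns, so every diagonal rises by
-- one; hence `suc k`.
In-tail : ∀ {x l k} a → All (In (x ∷ l)) (config k (map suc a)) → All (In l) (config (suc k) a)
In-tail {x} {l} {k} []      _          = []
In-tail {x} {l} {k} (v ∷ a) (in-l ∷ ins) =
  subst (λ j → In l (suc v , suc j)) (sym (+-suc v k)) in-l ∷ In-tail a ins

In-cons : ∀ {x l k} a → All (In l) (config (suc k) a) → All (In (x ∷ l)) (config k (map suc a))
In-cons {x} {l} {k} []      _          = []
In-cons {x} {l} {k} (v ∷ a) (in-l ∷ ins) =
  subst (λ j → In l (suc v , suc j)) (+-suc v k) in-l ∷ In-cons a ins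

placements-∈⁻ : ∀ l k r {a} → a ∈ placements l k r → Placement l k r a
placements-∈⁻ []      k zero (here refl) = placement refl [] []
placements-∈⁻ (x ∷ l) = ∷-case
  where
  ∷-case : ∀ k r {a} → a ∈ placements (x ∷ l) k r → Placement (x ∷ l) k r a
  ∷-case k zero (here refl) = placement refl [] []
  ∷-case k (suc r) a∈
    with ∈-++⁻ (if k <ᵇ x then map (0 ∷_) (placements (x ∷ l) (suc k) r) else []) a∈
  ... | inj₂ a∈ with b , b∈ , refl ← ∈-map⁻ (map suc) a∈
                with placement len lin ins ← placements-∈⁻ l (suc k) (suc r) b∈
    = placement (trans (length-map suc b) len) (Linked.map⁺ (Linked.map s≤s lin)) (In-cons b ins)
  ... | inj₁ a∈ with k <ᵇ x in k<x
  ...   | true with b , b∈ , refl ← ∈-map⁻ (0 ∷_) a∈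
               with placement len lin ins ← ∷-case (suc k) r b∈
    = placement (cong suc len) (Linked-zeros 1 lin) (subst T (sym k<x) _ ∷ ins)

placements-∈⁺ : ∀ l k r {a} → Placement l k r a → a ∈ placements l k r
placements-∈⁺ l       k zero {[]} _ = here refl
placements-∈⁺ []      k (suc r) {_ ∷ _} (placement _ _ (() ∷ _))
placements-∈⁺ (x ∷ l) k (suc r) {zero ∷ a} (placement len lin (in-l ∷ ins)) with true ← k <ᵇ x =
  ∈-++⁺ˡ (∈-map⁺ (0 ∷_) (placements-∈⁺ (x ∷ l) (suc k) r (placement (suc-injective len) (Linked.tail lin) ins)))
placements-∈⁺ (x ∷ l) k (suc r) {suc v ∷ a} (placement len lin ins) =
  ∈-++⁺ʳ (if k <ᵇ x then map (0 ∷_) (placements (x ∷ l) (suc k) r) else [])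
    (subst (_∈ map (map suc) (placements l (suc k) (suc r))) (sym a≡) (∈-map⁺ (map suc)
      (placements-∈⁺ l (suc k) (suc r) {b} (placement (trans (sym (length-map suc b)) (trans (cong length (sym a≡)) len))
        (Linked.map ℕ.s≤s⁻¹ (Linked.map⁻ (subst (Linked _≤_) a≡ lin)))
        (In-tail b (subst (λ a → All (In (x ∷ l)) (config k a)) a≡ ins))))))
  where
  -- The first count is positive, so by sortedness all are, and subtracting one loses nothing.
  b = map ℕ.pred (suc v ∷ a)
  map-suc-pred : ∀ {u} a → Linked _≤_ (suc u ∷ a) → a ≡ map suc (map ℕ.pred a)
  map-suc-pred []          _          = refl
  map-suc-pred (suc w ∷ a) (_ ∷ lin) = cong (suc w ∷_) (map-suc-pred a lin)
  a≡ : suc v ∷ a ≡ map suc b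
  a≡ = cong (suc v ∷_) (map-suc-pred a lin)

placements-unique : ∀ l k r → Unique (placements l k r)
placements-unique l       k zero    = [] ∷ []
placements-unique []      k (suc r) = []
placements-unique (x ∷ l) k (suc r) =
  Unique.++⁺ (resting (k <ᵇ x))
    (Unique.map⁺ (map-injective suc-injective) (placements-unique l (suc k) (suc r)))
    (λ (a∈ , a∈′) → disjoint (k <ᵇ x) a∈ a∈′)
  where
  resting : ∀ b → Unique (if b then map (0 ∷_) (placements (x ∷ l) (suc k) r) else [])
  resting false = []
  resting true  = Unique.map⁺ (proj₂ ∘ ∷-injective) (placements-unique (x ∷ l) (suc k) r)
  disjoint : ∀ b {a} → a ∈ (if b then map (0 ∷_) (placements (x ∷ l) (suc k) r) else []) →
             a ∈ map (map suc) (placements l (suc k) (suc r)) → ⊥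
  disjoint true a∈ a∈′ with _ , _ , refl ← ∈-map⁻ (0 ∷_) a∈ with ∈-map⁻ (map suc) a∈′
  ... | [] , b∈ , ()
  ... | _ ∷ _ , b∈ , ()

-- The first row reaches this column, so column length and row index both grow by one and the leg is
-- unchanged.
hook-tail : ∀ {x l} → Linked _≥_ (x ∷ l) → ∀ {i j} → j < row l (suc i) →
            hook (x ∷ l) (suc (suc i) , suc j) ≡ hook l (suc i , suc j)
hook-tail {x} {l} xl↘ {i} {j} j<row
  rewrite <⇒𝟙≡1 {j} {x} (<-≤-trans j<row (row-≤-head xl↘ (suc i))) = refl

weight-map-suc : ∀ {x l} → Linked _≥_ (x ∷ l) → ∀ k a → All (In l) (config (suc k) a) →
                 weight (x ∷ l) (config k (map suc a)) ≡ weight l (config (suc k) a)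
weight-map-suc {x} {l} xl↘ k []      _            = refl
weight-map-suc {x} {l} xl↘ k (v ∷ a) (in-l ∷ ins) = cong₂ ℕ._*_ first (weight-map-suc xl↘ (suc k) a ins)
  where
  first : hook (x ∷ l) (suc (suc v) , suc (suc v ℕ.+ k)) ≡ hook l (suc v , suc (v ℕ.+ suc k))
  first rewrite sym (+-suc v k) = hook-tail xl↘ (In⇒< l {v} in-l)

sum-map-* : ∀ {A : Set} h (f : A → ℕ) xs → sum (map (λ x → h ℕ.* f x) xs) ≡ h ℕ.* sum (map f xs)
sum-map-* h f []       = sym (*-zeroʳ h)
sum-map-* h f (x ∷ xs) =
  trans (cong (h ℕ.* f x ℕ.+_) (sum-map-* h f xs)) (sym (*-distribˡ-+ h (f x) (sum (map f xs))))

sum-placements : ∀ {l} → Linked _≥_ l → ∀ k r →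
                 sum (map (weight l ∘ config k) (placements l k r)) ≡ pebbleSum l k r
sum-placements {[]}    _  k zero    = refl
sum-placements {[]}    _  k (suc r) = refl
sum-placements {x ∷ l} l↘ = ∷-case
  where
  open ≡-Reasoning
  w : ℕ → List ℕ → ℕ
  w k = weight (x ∷ l) ∘ config k
  h : ℕ → ℕ
  h k = hook (x ∷ l) (1 , suc k)

  moved : ∀ k r → sum (map (w k) (map (map suc) (placements l (suc k) (suc r)))) ≡ pebbleSum l (suc k) (suc r)
  moved k r = begin
    sum (map (w k) (map (map suc) as))         ≡⟨ cong sum (map-∘ as) ⟨
    sum (map (w k ∘ map suc) as)
      ≡⟨ cong sum (map-cong-local (All.tabulate λ {a} a∈ →
           weight-map-suc l↘ k a (inside (placements-∈⁻ l (suc k) (suc r) a∈)))) ⟩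
    sum (map (weight l ∘ config (suc k)) as)   ≡⟨ sum-placements (Linked.tail l↘) (suc k) (suc r) ⟩
    pebbleSum l (suc k) (suc r)                ∎
    where as = placements l (suc k) (suc r)

  rest : ∀ k as s b → sum (map (w (suc k)) as) ≡ s →
         sum (map (w k) (if b then map (0 ∷_) as else [])) ≡ (if b then h k ℕ.* s else 0)
  rest k as s false _ = refl
  rest k as s true eq = begin
    sum (map (w k) (map (0 ∷_) as))               ≡⟨ cong sum (map-∘ as) ⟨
    sum (map (λ a → h k ℕ.* w (suc k) a) as)      ≡⟨ sum-map-* (h k) (w (suc k)) as ⟩
    h k ℕ.* sum (map (w (suc k)) as)              ≡⟨ cong (h k ℕ.*_) eq ⟩
    h k ℕ.* s                                     ∎

  ∷-case : ∀ k r → sum (map (w k) (placements (x ∷ l) k r)) ≡ pebbleSum (x ∷ l) k r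
  ∷-case k zero    = refl
  ∷-case k (suc r) = begin
    sum (map (w k) (as ++ bs))                     ≡⟨ cong sum (map-++ (w k) as bs) ⟩
    sum (map (w k) as ++ map (w k) bs)             ≡⟨ sum-++ (map (w k) as) (map (w k) bs) ⟩
    sum (map (w k) as) ℕ.+ sum (map (w k) bs)
      ≡⟨ cong₂ ℕ._+_ (rest k (placements (x ∷ l) (suc k) r) _ (k <ᵇ x) (∷-case (suc k) r)) (moved k r) ⟩
    pebbleSum (x ∷ l) k (suc r)                    ∎
    where
    as = if k <ᵇ x then map (0 ∷_) (placements (x ∷ l) (suc k) r) else []
    bs = map (map suc) (placements l (suc k) (suc r))

-- The excitation factor of a one-row partition

cellsOf-row : ∀ m → cellsOf (m ∷ []) ≡ config 0 (replicate m 0)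
cellsOf-row m = trans (++-identityʳ _) (go 0 m _ λ j → sym (+-identityʳ j))
  where
  -- `upTo` is `applyUpTo` of the identity, and each recursive call composes the function with
  -- `suc`; hence a general `g`.
  go : ∀ k m (g : ℕ → ℕ) → (∀ j → g j ≡ j ℕ.+ k) →
       map (λ j → (1 , suc j)) (applyUpTo g m) ≡ config k (replicate m 0)
  go k zero    g g≡ = refl
  go k (suc m) g g≡ = cong₂ _∷_ (cong (λ j → 1 , suc j) (g≡ 0))
    (go (suc k) m (g ∘ suc) λ j → trans (g≡ (suc j)) (sym (+-suc j k)))

row-cells-inside : ∀ {x l} k m → m ℕ.+ k ≤ x → All (In (x ∷ l)) (config k (replicate m 0))
row-cells-inside k zero    _    = []
row-cells-inside {x} {l} k (suc m) m+k<x =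
  <⇒In (x ∷ l) {0} (≤-<-trans (m≤n+m k m) m+k<x)
  ∷ row-cells-inside (suc k) m (subst (_≤ x) (sym (+-suc m k)) m+k<x)

<row⇒<length : ∀ l i {j} → j < row l (suc i) → i < length l
<row⇒<length (x ∷ l) zero    _   = s≤s z≤n
<row⇒<length (x ∷ l) (suc i) j< = s≤s (<row⇒<length l i j<)

-- A pebble inside `l` has moved fewer than `length l` times. The bound matches the number of rounds
-- in `excitedDiagrams`.
sum-placement-≤ : ∀ {l} k a → All (In l) (config k a) → sum a ≤ length a ℕ.* length l
sum-placement-≤ {l} k []      _            = z≤n
sum-placement-≤ {l} k (v ∷ a) (in-l ∷ ins) =
  +-mono-≤ (<⇒≤ (<row⇒<length l v (In⇒< l {v} in-l))) (sum-placement-≤ {l} (suc k) a ins)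

-- The reached configurations and the images of the placements form two duplicate-free lists with
-- the same elements, hence permutations of each other with equal sums of weights.
excitationFactor-row : ∀ {x l} → Linked _≥_ (x ∷ l) → ∀ m → m ≤ x →
                       excitationFactor (m ∷ []) (x ∷ l) ≡ pebbleSum (x ∷ l) 0 m
excitationFactor-row {x} {l} xl↘ m m≤x
  rewrite cellsOf-row m | +-identityʳ m = begin
  sum (map w reached)                                ≡⟨ sum-↭ (↭-map⁺ w (∼bag⇒↭ (unique∧set⇒bag unique unique′ (mk⇔ to from)))) ⟩
  sum (map w (map (config 0) (placements xl 0 m)))   ≡⟨ cong sum (map-∘ (placements xl 0 m)) ⟨
  sum (map (w ∘ config 0) (placements xl 0 m))       ≡⟨ sum-placements xl↘ 0 m ⟩
  pebbleSum xl 0 m                                   ∎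
  where
  open ≡-Reasoning
  xl = x ∷ l
  w  = weight xl
  n  = m ℕ.* length xl
  reached = reachWithin xl n (start xl↘ m)
  open Reach xl (IsPlacement xl m) (IsPlacement-sameSet xl m) (Placement-move xl m)
  unique : Unique reached
  unique = reach-unique xl n (start xl↘ m)
  unique′ : Unique (map (config 0) (placements xl 0 m))
  unique′ = Unique.map⁺ (config-injective 0) (placements-unique xl 0 m)
  start-P : All (IsPlacement xl m) (start xl↘ m)
  start-P = (replicate m 0 , refl , placement (length-replicate m)
    (subst (Linked _≤_) (++-identityʳ _) (Linked-zeros m []))
    (row-cells-inside 0 m (subst (_≤ x) (sym (+-identityʳ m)) m≤x))) ∷ []
  to : ∀ {c} → c ∈ reached → c ∈ map (config 0) (placements xl 0 m)
  to c∈ with a , refl , pa ← All.lookup (reach-P n start-P) c∈ =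
    ∈-map⁺ (config 0) (placements-∈⁺ xl 0 m pa)
  from : ∀ {c} → c ∈ map (config 0) (placements xl 0 m) → c ∈ reached
  from c∈ with a , a∈ , refl ← ∈-map⁻ (config 0) c∈ with pa ← placements-∈⁻ xl 0 m a∈ =
    reach-all xl↘ m start-P n pa
      (subst (λ s → sum a ≤ s ℕ.* length xl) (size pa) (sum-placement-≤ {xl} 0 a (inside pa)))

E≡pebbleSum : ∀ p m → E m p ≡ pebbleSum (parts p) 0 m
E≡pebbleSum p zero = refl
E≡pebbleSum (mkPartition []      _  _) (suc m) = refl
E≡pebbleSum (mkPartition (x ∷ l) xl↘ _) (suc m) with m <ᵇ x in eq
... | true  = excitationFactor-row xl↘ (suc m) (<ᵇ⇒< m x (subst T (sym eq) _))
-- For `suc m > x` the convention sets `E` to 0, and `pebbleSum` vanishes because the last pebble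
-- starts outside.
... | false = sym (pebbleSum-beyond xl↘ 0 m (s≤s (≮⇒≥ λ m<x → subst T eq (<⇒<ᵇ m<x))))

theorem4p1 : (lam lam' : Partition) → ((m : ℕ) → E m lam ≡ E m lam') → parts lam ≡ parts lam'
theorem4p1 lam lam' E≡ =
  pebbleSum-determines (decreasing lam) (decreasing lam') (positive lam) (positive lam') λ m →
    trans (sym (E≡pebbleSum lam m)) (trans (E≡ m) (E≡pebbleSum lam' m))
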